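{- The satisfiability and the finite satisfiability problems for $\mathrm{UNFO}$ with four variables, two functional binary relations and some unary relations (even without transitive relations) are undecidable.
   Context: $\mathrm{UNFO}$ formulas are given by $\phi ::= B\bar x \mid x=y \mid \phi\wedge\phi \mid \phi\vee\phi \mid \exists x\,\phi \mid \neg\phi(x)$, where in the last clause $\phi$ has at most the free variable $x$. The problem considered: given a $\mathrm{UNFO}$ sentence using at most four variables over a signature consisting of two binary symbols and unary symbols, decide whether it has a (finite) model in which the two binary symbols are interpreted as functional relations (each element has at most one successor). -}

module Defs where

open import Level using (0ℓ)
open import Data.Nat using (ℕ; zero; suc; _+_; _*_; _<_; ⌊_/2⌋)
open import Data.Fin using (Fin; toℕ)
open import Data.Vec using (Vec; []; _∷_; lookup)
open import Data.Bool using (Bool; true; false; T; if_then_else_)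
open import Data.Product using (Σ; ∃; _×_; _,_)
open import Data.Sum using (_⊎_)
open import Data.Empty using (⊥)
open import Relation.Nullary using (¬_)
open import Relation.Binary.PropositionalEquality using (_≡_)
open import Function.Bundles using (_⇔_)

Var : Set
Var = Fin 4

data Formula : Set where
  unary  : ℕ → Var → Formula
  binary : Fin 2 → Var → Var → Formula
  eq     : Var → Var → Formula
  and    : Formula → Formula → Formula
  or     : Formula → Formula → Formula
  ex     : Var → Formula → Formula
  neg    : Var → Formula → Formula        -- ¬ φ(x)  (well-formed only if FV φ ⊆ {x})

data FreeIn (y : Var) : Formula → Set where
  unary   : ∀ {k} → FreeIn y (unary k y)
  binaryˡ : ∀ {i z} → FreeIn y (binary i y z)
  binaryʳ : ∀ {i z} → FreeIn y (binary i z y)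
  eqˡ     : ∀ {z} → FreeIn y (eq y z)
  eqʳ     : ∀ {z} → FreeIn y (eq z y)
  andˡ    : ∀ {φ ψ} → FreeIn y φ → FreeIn y (and φ ψ)
  andʳ    : ∀ {φ ψ} → FreeIn y ψ → FreeIn y (and φ ψ)
  orˡ     : ∀ {φ ψ} → FreeIn y φ → FreeIn y (or φ ψ)
  orʳ     : ∀ {φ ψ} → FreeIn y ψ → FreeIn y (or φ ψ)
  ex      : ∀ {x φ} → ¬ (y ≡ x) → FreeIn y φ → FreeIn y (ex x φ)
  neg     : ∀ {x φ} → FreeIn y φ → FreeIn y (neg x φ)

data UNFO : Formula → Set where
  unary  : ∀ {k x} → UNFO (unary k x)
  binary : ∀ {i x y} → UNFO (binary i x y)
  eq     : ∀ {x y} → UNFO (eq x y)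
  and    : ∀ {φ ψ} → UNFO φ → UNFO ψ → UNFO (and φ ψ)
  or     : ∀ {φ ψ} → UNFO φ → UNFO ψ → UNFO (or φ ψ)
  ex     : ∀ {x φ} → UNFO φ → UNFO (ex x φ)
  neg    : ∀ {x φ} → UNFO φ → (∀ y → FreeIn y φ → y ≡ x) → UNFO (neg x φ)

Sentence : Formula → Set
Sentence φ = UNFO φ × (∀ y → ¬ FreeIn y φ)

record Structure : Set₁ where
  field
    Carrier : Set
    U       : ℕ → Carrier → Set
    R       : Fin 2 → Carrier → Carrier → Set

open Structure public

Functional : Structure → Set
Functional M = ∀ i a b c → R M i a b → R M i a c → b ≡ c

update : {A : Set} → (Var → A) → Var → A → (Var → A)
update ρ x a y with y Data.Fin.≟ x
... | Relation.Nullary.yes _ = a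
... | Relation.Nullary.no  _ = ρ y

_⊨_[_] : (M : Structure) → Formula → (Var → Carrier M) → Set
M ⊨ unary k x    [ ρ ] = U M k (ρ x)
M ⊨ binary i x y [ ρ ] = R M i (ρ x) (ρ y)
M ⊨ eq x y       [ ρ ] = ρ x ≡ ρ y
M ⊨ and φ ψ      [ ρ ] = (M ⊨ φ [ ρ ]) × (M ⊨ ψ [ ρ ])
M ⊨ or φ ψ       [ ρ ] = (M ⊨ φ [ ρ ]) ⊎ (M ⊨ ψ [ ρ ])
M ⊨ ex x φ       [ ρ ] = Σ (Carrier M) λ a → M ⊨ φ [ update ρ x a ]
M ⊨ neg x φ      [ ρ ] = ¬ (M ⊨ φ [ ρ ])

-- has a model (nonempty domain, witnessed by an assignment) with
-- functional binary relations
Satisfiable : Formula → Set₁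
Satisfiable φ = Σ Structure λ M → Functional M × Σ (Var → Carrier M) λ ρ → M ⊨ φ [ ρ ]

FinSatisfiable : Formula → Set₁
FinSatisfiable φ = Σ Structure λ M → Functional M × Σ ℕ λ n → (Carrier M ≡ Fin n) ×
                   Σ (Var → Carrier M) λ ρ → M ⊨ φ [ ρ ]

data PR : ℕ → Set where
  zer  : ∀ {n} → PR n
  succ : PR 1
  proj : ∀ {n} → Fin n → PR n
  comp : ∀ {m n} → PR m → Vec (PR n) m → PR n
  prec : ∀ {n} → PR n → PR (suc (suc n)) → PR (suc n)
  mu   : ∀ {n} → PR (suc n) → PR n

mutual
  data _⟦_⟧⇓_ : ∀ {n} → PR n → Vec ℕ n → ℕ → Set where
    zer   : ∀ {n} {v : Vec ℕ n} → zer ⟦ v ⟧⇓ 0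
    succ  : ∀ {x} → succ ⟦ x ∷ [] ⟧⇓ suc x
    proj  : ∀ {n} {v : Vec ℕ n} i → proj i ⟦ v ⟧⇓ lookup v i
    comp  : ∀ {m n} {f : PR m} {gs : Vec (PR n) m} {v ws r} →
            gs ⟦ v ⟧⇓* ws → f ⟦ ws ⟧⇓ r → comp f gs ⟦ v ⟧⇓ r
    prec0 : ∀ {n} {f : PR n} {g v r} → f ⟦ v ⟧⇓ r → prec f g ⟦ 0 ∷ v ⟧⇓ r
    precS : ∀ {n} {f : PR n} {g v k r′ r} →
            prec f g ⟦ k ∷ v ⟧⇓ r′ → g ⟦ k ∷ r′ ∷ v ⟧⇓ r →
            prec f g ⟦ suc k ∷ v ⟧⇓ r
    mu    : ∀ {n} {f : PR (suc n)} {v k} → f ⟦ k ∷ v ⟧⇓ 0 →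
            (∀ j → j < k → Σ ℕ λ m → f ⟦ j ∷ v ⟧⇓ suc m) → mu f ⟦ v ⟧⇓ k

  data _⟦_⟧⇓*_ : ∀ {m n} → Vec (PR n) m → Vec ℕ n → Vec ℕ m → Set where
    []  : ∀ {n} {v : Vec ℕ n} → [] ⟦ v ⟧⇓* []
    _∷_ : ∀ {m n} {g : PR n} {gs : Vec (PR n) m} {v r rs} →
          g ⟦ v ⟧⇓ r → gs ⟦ v ⟧⇓* rs → (g ∷ gs) ⟦ v ⟧⇓* (r ∷ rs)

-- Gödel numbering of formulas (Cantor pairing)

pair : ℕ → ℕ → ℕ
pair a b = ⌊ (a + b) * suc (a + b) /2⌋ + b

code : Formula → ℕ
code (unary k x)    = pair 0 (pair k (toℕ x))
code (binary i x y) = pair 1 (pair (toℕ i) (pair (toℕ x) (toℕ y)))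
code (eq x y)       = pair 2 (pair (toℕ x) (toℕ y))
code (and φ ψ)      = pair 3 (pair (code φ) (code ψ))
code (or φ ψ)       = pair 4 (pair (code φ) (code ψ))
code (ex x φ)       = pair 5 (pair (toℕ x) (code φ))
code (neg x φ)      = pair 6 (pair (toℕ x) (code φ))

bit : Bool → ℕ
bit true  = 1
bit false = 0

DecidesOnSentences : PR 1 → (Formula → Set₁) → Set₁
DecidesOnSentences p P =
  ∀ φ → Sentence φ → Σ Bool λ b → (p ⟦ code φ ∷ [] ⟧⇓ bit b) × (T b ⇔ P φ)

Undecidable : (Formula → Set₁) → Set₁
Undecidable P = ¬ (Σ (PR 1) λ p → DecidesOnSentences p P)

{-# OPTIONS --safe #-}

-- A run of a register machine is drawn as a grid, one configuration per row, with registers in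
-- unary. Two functional relations suffice for the grid: four variables express that "right, then
-- down" and "down, then right" lead to the same cell, and the transition rules are constraints on
-- such squares, which need only unary negation. The resulting sentence forbids output 1, so it is
-- unsatisfiable if the machine outputs 1 and has a finite model if the machine outputs 0.
--
-- Suppose p decides a property lying between finite satisfiability and satisfiability. Let a
-- machine on input x run p on the code of the conjunction of the formula with code x and the
-- sentence saying that the input is x. Its grid formula, given its own code as input, is a
-- sentence on which p errs. As p always answers 0 or 1, only halting runs matter.

module Submission where

open import Defs
open import Data.Bool using (Bool; T; if_then_else_; true; false)
open import Data.Fin using (Fin; zero; suc; toℕ; combine; remQuot)
open import Data.Fin.Properties using (remQuot-combine; toℕ<n)
open import Data.List using (List; []; _∷_; _++_; length)
open import Data.List.Properties using (length-++)
open import Data.Maybe using (Maybe; just; nothing; maybe)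
open import Data.Nat using (ℕ; zero; suc; pred; _+_; _*_; _<_; _≤_; z≤n; s≤s; ⌊_/2⌋; _≟_; _<?_; _≤?_)
open import Data.Nat.Properties hiding (_≟_; _<?_; _≤?_)
open import Data.Nat.Tactic.RingSolver using (solve-∀)
open import Data.Product using (Σ; _×_; _,_; proj₁; proj₂)
open import Data.Sum using (_⊎_; inj₁; inj₂)
open import Data.Unit using (⊤; tt)
open import Data.Empty using (⊥)
open import Data.Vec using (Vec; []; _∷_; lookup)
open import Data.Vec.Relation.Binary.Pointwise.Inductive as Pointwise using (Pointwise; []; _∷_)
open import Function.Bundles using (Equivalence; _⇔_)
open import Relation.Nullary using (¬_; Dec; does; yes; no; contradiction)
open import Relation.Nullary.Decidable using (dec-true; dec-false; _×-dec_)
open import Relation.Binary.PropositionalEquality using (_≡_; _≢_; refl; sym; trans; cong; cong₂; subst)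

-- Primitive recursive building blocks

constant : ∀ {n} → ℕ → PR n
constant zero    = zer
constant (suc k) = comp succ (constant k ∷ [])

constant-⇓ : ∀ {n} k (v : Vec ℕ n) → constant k ⟦ v ⟧⇓ k
constant-⇓ zero    v = zer
constant-⇓ (suc k) v = comp (constant-⇓ k v ∷ []) succ

addition : PR 2
addition = prec (proj zero) (comp succ (proj (suc zero) ∷ []))

addition-⇓ : ∀ a b → addition ⟦ a ∷ b ∷ [] ⟧⇓ (a + b)
addition-⇓ zero    b = prec0 (proj zero)
addition-⇓ (suc a) b = precS (addition-⇓ a b) (comp (proj (suc zero) ∷ []) succ)

triangle : ℕ → ℕ
triangle n = ⌊ n * suc n /2⌋

⌊m+n+n/2⌋ : ∀ m n → ⌊ n + (n + m) /2⌋ ≡ n + ⌊ m /2⌋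
⌊m+n+n/2⌋ m zero    = refl
⌊m+n+n/2⌋ m (suc n) rewrite +-suc n (n + m) = cong suc (⌊m+n+n/2⌋ m n)

-- The Cantor pairing halves a product; by this recurrence `triangular` computes that half with
-- additions alone.
triangle-suc : ∀ k → triangle (suc k) ≡ suc k + triangle k
triangle-suc k = trans (cong ⌊_/2⌋ (expand k)) (⌊m+n+n/2⌋ (k * suc k) (suc k))
  where
  expand : ∀ k → suc k * suc (suc k) ≡ suc k + (suc k + k * suc k)
  expand = solve-∀

triangular : PR 1
triangular = prec zer (comp addition (comp succ (proj zero ∷ []) ∷ proj (suc zero) ∷ []))

triangular-⇓ : ∀ n → triangular ⟦ n ∷ [] ⟧⇓ triangle n
triangular-⇓ zero    = prec0 zer
triangular-⇓ (suc n) = subst (triangular ⟦ suc n ∷ [] ⟧⇓_) (sym (triangle-suc n))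
  (precS (triangular-⇓ n)
    (comp (comp (proj zero ∷ []) succ ∷ proj (suc zero) ∷ []) (addition-⇓ (suc n) (triangle n))))

pairing : PR 2
pairing = comp addition (comp triangular (addition ∷ []) ∷ proj (suc zero) ∷ [])

pairing-⇓ : ∀ a b → pairing ⟦ a ∷ b ∷ [] ⟧⇓ pair a b
pairing-⇓ a b =
  comp (comp (addition-⇓ a b ∷ []) (triangular-⇓ (a + b)) ∷ proj (suc zero) ∷ [])
       (addition-⇓ (triangle (a + b)) b)

-- Inputs of type A are presented to the program through the coding e.
record Computable {A : Set} (e : A → ℕ) (F : A → Formula) : Set where
  constructor computes
  field
    algorithm : PR 1
    correct   : ∀ a → algorithm ⟦ e a ∷ [] ⟧⇓ code (F a)

open Computable

constructing : ∀ {n} → ℕ → PR n → PR n → PR n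
constructing k p q = comp pairing (constant k ∷ comp pairing (p ∷ q ∷ []) ∷ [])

constructing-⇓ : ∀ {n k} {p q : PR n} {v a b} → p ⟦ v ⟧⇓ a → q ⟦ v ⟧⇓ b →
                 constructing k p q ⟦ v ⟧⇓ pair k (pair a b)
constructing-⇓ {k = k} {v = v} {a} {b} p⇓ q⇓ =
  comp (constant-⇓ k v ∷ comp (p⇓ ∷ q⇓ ∷ []) (pairing-⇓ a b) ∷ []) (pairing-⇓ k (pair a b))

module _ {A : Set} {e : A → ℕ} where

  constant-computable : ∀ φ → Computable e (λ _ → φ)
  constant-computable φ = computes (constant (code φ)) (λ a → constant-⇓ (code φ) (e a ∷ []))

  and-computable : ∀ {F G : A → Formula} → Computable e F → Computable e G →
                   Computable e (λ a → and (F a) (G a))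
  and-computable c d =
    computes (constructing 3 (algorithm c) (algorithm d)) (λ a → constructing-⇓ (correct c a) (correct d a))

  ex-computable : ∀ x {F : A → Formula} → Computable e F → Computable e (λ a → ex x (F a))
  ex-computable x c =
    computes (constructing 5 (constant (toℕ x)) (algorithm c))
             (λ a → constructing-⇓ (constant-⇓ (toℕ x) (e a ∷ [])) (correct c a))

-- The input is already the code of the output, so a projection suffices. The diagonal argument
-- feeds formulas to programs in this way.
coding-computable : ∀ {A : Set} (F : A → Formula) → Computable (λ a → code (F a)) F
coding-computable F = computes (proj zero) (λ a → proj zero)

reindex-computable : ∀ {A B : Set} {e : A → ℕ} {F : A → Formula} (g : B → A) →
                     Computable e F → Computable (λ b → e (g b)) (λ b → F (g b))
reindex-computable g c = computes (algorithm c) (λ b → correct c (g b))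

-- Only the action of `G` on codes has to be computable: primitive recursion on `n` then iterates
-- it. Meant for `tape`, nested to depth `n`.
iterate-computable : ∀ (F : ℕ → Formula) (G : Formula → Formula) → (∀ n → F (suc n) ≡ G (F n)) →
                     Computable code G → Computable (λ n → n) F
iterate-computable F G F-suc c = computes p p⇓
  where
  p : PR 1
  p = prec (constant (code (F 0))) (comp (algorithm c) (proj (suc zero) ∷ []))
  p⇓ : ∀ n → p ⟦ n ∷ [] ⟧⇓ code (F n)
  p⇓ zero    = prec0 (constant-⇓ (code (F 0)) [])
  p⇓ (suc n) = subst (λ φ → p ⟦ suc n ∷ [] ⟧⇓ code φ) (sym (F-suc n))
    (precS (p⇓ n) (comp (proj (suc zero) ∷ []) (correct c (F n))))

-- Register machines

data Expr : Set where
  nil            : Expr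
  copy incr decr : ℕ → Expr

Store : Set
Store = ℕ → ℕ

eval : Expr → Store → ℕ
eval nil      σ = 0
eval (copy r) σ = σ r
eval (incr r) σ = suc (σ r)
eval (decr r) σ = pred (σ r)

-- An assignment is seen as a simultaneous update giving every register an expression, `copy` by
-- default. The grid formula describes a step register by register in this form.
source : ℕ → Expr → ℕ → Expr
source b e i = if does (i ≟ b) then e else copy i

_[_≔_] : Store → ℕ → Expr → Store
(σ [ b ≔ e ]) i = eval (source b e i) σ

assigned : ∀ σ b e → (σ [ b ≔ e ]) b ≡ eval e σ
assigned σ b e rewrite dec-true (b ≟ b) refl = refl

unassigned : ∀ σ b e i → i ≢ b → (σ [ b ≔ e ]) i ≡ σ i
unassigned σ b e i i≢b rewrite dec-false (i ≟ b) i≢b = refl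

data Instr : Set where
  assign : ℕ → Expr → Instr
  branch : (r onZero onSuc : ℕ) → Instr

Config : Set
Config = ℕ × Store

transfer : Instr → ℕ → Expr
transfer (assign b e)   i = source b e i
transfer (branch _ _ _) i = copy i

select : ℕ → ℕ → ℕ → ℕ
select zero    q₀ q₁ = q₀
select (suc _) q₀ q₁ = q₁

target : Instr → ℕ → Store → ℕ
target (assign _ _)     q σ = suc q
target (branch r q₀ q₁) q σ = select (σ r) q₀ q₁

exec : Instr → Config → Config
exec ι (q , σ) = target ι q σ , λ i → eval (transfer ι i) σ

Program : Set
Program = List Instr

fetch : Program → ℕ → Maybe Instr
fetch []       _       = nothing
fetch (ι ∷ ιs) zero    = just ι
fetch (ι ∷ ιs) (suc q) = fetch ιs q

fetch-< : ∀ π q {ι} → fetch π q ≡ just ι → q < length π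
fetch-< (_ ∷ _)  zero    _ = s≤s z≤n
fetch-< (_ ∷ ιs) (suc q) p = s≤s (fetch-< ιs q p)

fetch-length : ∀ π → fetch π (length π) ≡ nothing
fetch-length []      = refl
fetch-length (_ ∷ π) = fetch-length π

-- A location without instruction is a fixed point, so a halted run can be prolonged at will; the
-- last row of the finite model relies on this.
step : Program → Config → Config
step π c = maybe (λ ι → exec ι c) c (fetch π (proj₁ c))

run : Program → ℕ → Config → Config
run π zero    c = c
run π (suc t) c = run π t (step π c)

run-step : ∀ π t c → run π (suc t) c ≡ step π (run π t c)
run-step π zero    c = refl
run-step π (suc t) c = run-step π t (step π c)

Reaches : Program → Config → Config → Set
Reaches π c c′ = Σ ℕ λ t → run π t c ≡ c′

reaches-trans : ∀ {π c₁ c₂ c₃} → Reaches π c₁ c₂ → Reaches π c₂ c₃ → Reaches π c₁ c₃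
reaches-trans (zero  , refl) r = r
reaches-trans {π} {c₁} (suc t , p) r with reaches-trans {π} {step π c₁} (t , p) r
... | t′ , p′ = suc t′ , p′

reaches-step : ∀ {π q σ ι} → fetch π q ≡ just ι → Reaches π (q , σ) (exec ι (q , σ))
reaches-step {π} {q} {σ} p = 1 , cong (maybe (λ ι → exec ι (q , σ)) (q , σ)) p

-- Structured programs

infixr 5 _⨾_
infix  5.5 _≔_

data Cmd : Set where
  skip  : Cmd
  _≔_   : ℕ → Expr → Cmd
  _⨾_   : Cmd → Cmd → Cmd
  while : ℕ → Cmd → Cmd

infix 4 _∶_⇓_

data _∶_⇓_ : Cmd → Store → Store → Set where
  skip   : ∀ {σ} → skip ∶ σ ⇓ σ
  set    : ∀ {b e σ} → b ≔ e ∶ σ ⇓ σ [ b ≔ e ]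
  _⨾_    : ∀ {c d σ σ′ σ″} → c ∶ σ ⇓ σ′ → d ∶ σ′ ⇓ σ″ → c ⨾ d ∶ σ ⇓ σ″
  while₀ : ∀ {r c σ} → σ r ≡ 0 → while r c ∶ σ ⇓ σ
  while₁ : ∀ {r c σ σ′ σ″ m} → σ r ≡ suc m → c ∶ σ ⇓ σ′ → while r c ∶ σ′ ⇓ σ″ → while r c ∶ σ ⇓ σ″

size : Cmd → ℕ
size skip        = 0
size (_ ≔ _)     = 1
size (c ⨾ d)     = size c + size d
size (while _ c) = suc (size c + 1)

-- Branch targets are absolute, hence the offset `o`. The instruction `branch 0 o o` has equal
-- targets and serves as an unconditional jump back to the loop test.
flatten : Cmd → ℕ → Program
flatten skip        o = []
flatten (b ≔ e)     o = assign b e ∷ []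
flatten (c ⨾ d)     o = flatten c o ++ flatten d (o + size c)
flatten (while r c) o =
  branch r (o + size (while r c)) (suc o) ∷ flatten c (suc o) ++ branch 0 o o ∷ []

length-flatten : ∀ c o → length (flatten c o) ≡ size c
length-flatten skip        o = refl
length-flatten (_ ≔ _)     o = refl
length-flatten (c ⨾ d)     o =
  trans (length-++ (flatten c o)) (cong₂ _+_ (length-flatten c o) (length-flatten d (o + size c)))
length-flatten (while _ c) o =
  cong suc (trans (length-++ (flatten c (suc o))) (cong (_+ 1) (length-flatten c (suc o))))

CodeAt : Program → ℕ → Program → Set
CodeAt π o []       = ⊤
CodeAt π o (ι ∷ ιs) = fetch π o ≡ just ι × CodeAt π (suc o) ιs

codeAt-++ : ∀ {π} xs {ys o m} → length xs ≡ m → CodeAt π o (xs ++ ys) → CodeAt π o xs × CodeAt π (o + m) ys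
codeAt-++ {π} []       {ys} {o} refl at = tt , subst (λ k → CodeAt π k ys) (sym (+-identityʳ o)) at
codeAt-++ {π} (x ∷ xs) {ys} {o} refl (p , at) with codeAt-++ xs refl at
... | at₁ , at₂ = (p , at₁) , subst (λ k → CodeAt π k ys) (sym (+-suc o (length xs))) at₂

codeAt-there : ∀ {ι π o} xs → CodeAt π o xs → CodeAt (ι ∷ π) (suc o) xs
codeAt-there []       at       = tt
codeAt-there (x ∷ xs) (p , at) = p , codeAt-there xs at

codeAt-self : ∀ π → CodeAt π 0 π
codeAt-self []      = tt
codeAt-self (ι ∷ π) = refl , codeAt-there π (codeAt-self π)

flatten-correct : ∀ {π c σ σ′ o} → CodeAt π o (flatten c o) → c ∶ σ ⇓ σ′ →
                  Reaches π (o , σ) (o + size c , σ′)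
flatten-correct {π} {σ = σ} {o = o} at skip =
  subst (λ k → Reaches π (o , σ) (k , σ)) (sym (+-identityʳ o)) (0 , refl)
flatten-correct {π} {σ = σ} {o = o} (p , _) (set {b} {e}) =
  subst (λ k → Reaches π (o , σ) (k , σ [ b ≔ e ])) (sym (+-comm o 1)) (reaches-step p)
flatten-correct {π} {σ = σ} {σ″} {o} at (_⨾_ {c} {d} ec ed)
  with codeAt-++ (flatten c o) (length-flatten c o) at
... | at₁ , at₂ = subst (λ k → Reaches π (o , σ) (k , σ″)) (+-assoc o (size c) (size d))
                    (reaches-trans (flatten-correct at₁ ec) (flatten-correct at₂ ed))
flatten-correct {π} {σ = σ} {o = o} (p , _) (while₀ {r} {c} z) =
  subst (λ n → Reaches π (o , σ) (select n (o + size (while r c)) (suc o) , σ)) z (reaches-step p)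
flatten-correct {π} {σ = σ} {σ″} {o} at@(p , at′) (while₁ {r} {c} {σ′ = σ′} s ec ew)
  with codeAt-++ (flatten c (suc o)) (length-flatten c (suc o)) at′
... | at₁ , (j , _) =
  reaches-trans
    (subst (λ n → Reaches π (o , σ) (select n (o + size (while r c)) (suc o) , σ)) s (reaches-step p))
    (reaches-trans (flatten-correct at₁ ec)
      (reaches-trans back (flatten-correct at ew)))
  where
  back : Reaches π (suc o + size c , σ′) (o , σ′)
  back = subst (λ k → Reaches π (suc o + size c , σ′) (k , σ′)) (select-same (σ′ 0)) (reaches-step j)
    where
    select-same : ∀ n → select n o o ≡ o
    select-same zero    = refl
    select-same (suc _) = refl

-- Compiling recursive functions

range : ℕ → ∀ m → Vec ℕ m
range b zero    = []
range b (suc m) = b ∷ range (suc b) m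

searchBody : Cmd → ℕ → Cmd
searchBody c b = b ≔ incr b ⨾ c

-- Registers of a recursion: `b` holds the value so far, `1 + b` the index counting up, `2 + b` the
-- rounds left, and `3 + b` receives the new value.
recBody : Cmd → ℕ → Cmd
recBody c b = c ⨾ b ≔ copy (3 + b) ⨾ 1 + b ≔ incr (1 + b) ⨾ 2 + b ≔ decr (2 + b)

-- The arguments are read from the registers ls, all below b; the result goes to
-- register b, and registers above b are scratch space.
mutual
  compile : ∀ {n} → PR n → Vec ℕ n → ℕ → Cmd
  compile zer                ls       b = b ≔ nil
  compile succ               (l ∷ []) b = b ≔ incr l
  compile (proj i)           ls       b = b ≔ copy (lookup ls i)
  compile (comp {m} f gs)    ls       b =
    compileAll gs ls b ⨾ compile f (range b m) (m + b) ⨾ b ≔ copy (m + b)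
  compile (prec f g)         (l ∷ ls) b =
    compile f ls b ⨾ 1 + b ≔ nil ⨾ 2 + b ≔ copy l ⨾
    while (2 + b) (recBody (compile g (1 + b ∷ b ∷ ls) (3 + b)) b)
  compile (mu f)             ls       b =
    b ≔ nil ⨾ compile f (b ∷ ls) (1 + b) ⨾
    while (1 + b) (searchBody (compile f (b ∷ ls) (1 + b)) b)

  compileAll : ∀ {m n} → Vec (PR n) m → Vec ℕ n → ℕ → Cmd
  compileAll []       ls b = skip
  compileAll (g ∷ gs) ls b = compile g ls b ⨾ compileAll gs ls (suc b)

-- Correctness of the compiled programs

Agree : ℕ → Store → Store → Set
Agree b σ σ′ = ∀ j → j < b → σ′ j ≡ σ j

agree-trans : ∀ {b σ₁ σ₂ σ₃} → Agree b σ₁ σ₂ → Agree b σ₂ σ₃ → Agree b σ₁ σ₃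
agree-trans p q j j<b = trans (q j j<b) (p j j<b)

agree-≤ : ∀ {b b′ σ σ′} → b ≤ b′ → Agree b′ σ σ′ → Agree b σ σ′
agree-≤ b≤b′ p j j<b = p j (≤-trans j<b b≤b′)

agree-set : ∀ {b k σ e} → b ≤ k → Agree b σ (σ [ k ≔ e ])
agree-set {σ = σ} {e} b≤k j j<b = unassigned σ _ e j (<⇒≢ (≤-trans j<b b≤k))

Stored : Store → ℕ → ℕ → ℕ → Set
Stored σ b l x = l < b × σ l ≡ x

Args : Store → ℕ → ∀ {n} → Vec ℕ n → Vec ℕ n → Set
Args σ b = Pointwise (Stored σ b)

args-mono : ∀ {b b′ σ σ′ n} {ls v : Vec ℕ n} → b ≤ b′ → Agree b σ σ′ → Args σ b ls v → Args σ′ b′ ls v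
args-mono b≤b′ p = Pointwise.map λ (l<b , q) → ≤-trans l<b b≤b′ , trans (p _ l<b) q

Yields : Cmd → ℕ → ℕ → Store → Set
Yields c b r σ = Σ Store λ σ′ → c ∶ σ ⇓ σ′ × σ′ b ≡ r × Agree b σ σ′

yields-set : ∀ {b e σ r} → eval e σ ≡ r → Yields (b ≔ e) b r σ
yields-set {b} {e} {σ} p = _ , set , trans (assigned σ b e) p , agree-set ≤-refl

module Search {n} (c : Cmd) (b : ℕ) (ls v : Vec ℕ n) (k : ℕ)
  (last : ∀ σ → σ b ≡ k → Args σ b ls v → Yields c (1 + b) 0 σ)
  (rest : ∀ j → j < k → Σ ℕ λ m → ∀ σ → σ b ≡ j → Args σ b ls v → Yields c (1 + b) (suc m) σ)
  where

  -- The compiled search tests once before its loop, and each round increments and then tests.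
  -- Cutting a run after its first test makes the rest of a round, together with the rest of the
  -- loop, a run of the same shape.
  Probed : Store → Set
  Probed σ = Σ Store λ σ′ → c ∶ σ ⇓ σ′ ×
               (Σ Store λ σ″ → while (1 + b) (searchBody c b) ∶ σ′ ⇓ σ″ × σ″ b ≡ k × Agree b σ σ″)

  search : ∀ m j → m + j ≡ k → ∀ σ → σ b ≡ j → Args σ b ls v → Probed σ
  search zero    j refl σ p a with last σ p a
  ... | σ′ , e , z , ag = σ′ , e , σ′ , while₀ z , trans (ag b ≤-refl) p , agree-≤ (n≤1+n b) ag
  search (suc m) j refl σ p a with rest j (s≤s (m≤n+m j m))
  ... | _ , next with next σ p a
  ... | σ′ , e , z , ag
    with search m (suc j) (+-suc m j) (σ′ [ b ≔ incr b ])
           (trans (assigned σ′ b (incr b)) (cong suc (trans (ag b ≤-refl) p)))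
           (args-mono ≤-refl (agree-trans (agree-≤ (n≤1+n b) ag) (agree-set ≤-refl)) a)
  ... | σ₁ , e₁ , σ₂ , e₂ , q , ag₂ =
    σ′ , e , σ₂ , while₁ z (set ⨾ e₁) e₂ , q ,
    agree-trans (agree-≤ (n≤1+n b) ag) (agree-trans (agree-set ≤-refl) ag₂)

record Loop (b : ℕ) (σ₀ σ : Store) (r k m : ℕ) : Set where
  constructor loop
  field
    acc   : σ b ≡ r
    index : σ (1 + b) ≡ k
    left  : σ (2 + b) ≡ m
    agree : Agree b σ₀ σ

recBody-correct : ∀ {c b σ₀ σ r r′ k m} → Loop b σ₀ σ r k (suc m) → Yields c (3 + b) r′ σ →
                  Σ Store λ σ′ → recBody c b ∶ σ ⇓ σ′ × Loop b σ₀ σ′ r′ (suc k) m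
recBody-correct {c} {b} {σ₀} {σ} (loop _ i l ag) (σ₁ , e , p , ag₁) =
  σ₄ , e ⨾ set ⨾ set ⨾ set ,
  loop (trans (unassigned σ₃ (2 + b) (decr (2 + b)) b (<⇒≢ b<2+b))
         (trans (unassigned σ₂ (1 + b) (incr (1 + b)) b (<⇒≢ ≤-refl))
         (trans (assigned σ₁ b (copy (3 + b))) p)))
       (trans (unassigned σ₃ (2 + b) (decr (2 + b)) (1 + b) (<⇒≢ ≤-refl))
         (trans (assigned σ₂ (1 + b) (incr (1 + b)))
         (cong suc (trans (unassigned σ₁ b (copy (3 + b)) (1 + b) (>⇒≢ ≤-refl))
         (trans (ag₁ (1 + b) (n≤1+n _)) i)))))
       (trans (assigned σ₃ (2 + b) (decr (2 + b)))
         (cong pred (trans (unassigned σ₂ (1 + b) (incr (1 + b)) (2 + b) (>⇒≢ ≤-refl))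
         (trans (unassigned σ₁ b (copy (3 + b)) (2 + b) (>⇒≢ b<2+b)) (trans (ag₁ (2 + b) ≤-refl) l)))))
       (agree-trans ag (agree-trans (agree-≤ (m≤n+m b 3) ag₁) (agree-trans (agree-set ≤-refl)
         (agree-trans (agree-set (m≤n+m b 1)) (agree-set (m≤n+m b 2))))))
  where
  b<2+b : b < 2 + b
  b<2+b = n≤1+n (1 + b)
  σ₂ σ₃ σ₄ : Store
  σ₂ = σ₁ [ b ≔ copy (3 + b) ]
  σ₃ = σ₂ [ 1 + b ≔ incr (1 + b) ]
  σ₄ = σ₃ [ 2 + b ≔ decr (2 + b) ]

-- The loop runs upwards while derivations unfold downwards, so the first k
-- rounds are described by how they extend any run of the remaining ones.
Prefix : Cmd → Cmd → ℕ → Store → ℕ → ℕ → Set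
Prefix c d b σ k r = ∀ m → Σ Store λ σ₁ → c ∶ σ ⇓ σ₁ × Agree b σ σ₁ ×
  (∀ σ₂ → Loop b σ σ₂ (σ₁ b) 0 (k + m) →
    Σ Store λ σ₃ → Loop b σ σ₃ r k m ×
      (∀ σ₄ → while (2 + b) d ∶ σ₃ ⇓ σ₄ → while (2 + b) d ∶ σ₂ ⇓ σ₄))

mutual
  compile-correct : ∀ {n} {f : PR n} {v r} → f ⟦ v ⟧⇓ r →
                    ∀ ls b σ → Args σ b ls v → Yields (compile f ls b) b r σ
  compile-correct zer      ls       b σ a             = yields-set refl
  compile-correct succ     (l ∷ []) b σ ((_ , p) ∷ []) = yields-set (cong suc p)
  compile-correct (proj i) ls       b σ a             = yields-set (proj₂ (Pointwise.lookup a i))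
  compile-correct (comp {m} {gs = gs} ds d) ls b σ a
    with compileAll-correct ds ls b σ a
  ... | σ₁ , e₁ , a₁ , ag₁ with compile-correct d (range b m) (m + b) σ₁ a₁
  ... | σ₂ , e₂ , p , ag₂ =
    _ , e₁ ⨾ e₂ ⨾ set , trans (assigned σ₂ b (copy (m + b))) p ,
    agree-trans ag₁ (agree-trans (agree-≤ (m≤n+m b m) ag₂) (agree-set ≤-refl))
  compile-correct (prec0 d)   (l ∷ ls) b σ (s ∷ a) = prec-finish s (prefix-zero d ls b σ a)
  compile-correct (precS d e) (l ∷ ls) b σ (s ∷ a) = prec-finish s (prefix-suc d e ls b σ a)
  compile-correct (mu {k = k} d h) ls b σ a
    with Search.search _ b ls _ k
           (λ σ p a → compile-correct d (b ∷ ls) (1 + b) σ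
             ((≤-refl , p) ∷ args-mono (n≤1+n b) (λ _ _ → refl) a))
           (λ j j<k → mu-rest (h j j<k) ls b)
           k 0 (+-identityʳ k) (σ [ b ≔ nil ]) (assigned σ b nil) (args-mono ≤-refl (agree-set ≤-refl) a)
  ... | σ₁ , e₁ , σ₂ , e₂ , p , ag = σ₂ , set ⨾ e₁ ⨾ e₂ , p , agree-trans (agree-set ≤-refl) ag

  mu-rest : ∀ {n} {f : PR (suc n)} {j v} → (Σ ℕ λ m → f ⟦ j ∷ v ⟧⇓ suc m) → ∀ ls b → Σ ℕ λ m →
            ∀ σ → σ b ≡ j → Args σ b ls v → Yields (compile f (b ∷ ls) (1 + b)) (1 + b) (suc m) σ
  mu-rest (m , d) ls b = m , λ σ p a →
    compile-correct d (b ∷ ls) (1 + b) σ ((≤-refl , p) ∷ args-mono (n≤1+n b) (λ _ _ → refl) a)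

  prefix-zero : ∀ {n} {f : PR n} {g : PR (2 + n)} {v r} → f ⟦ v ⟧⇓ r → ∀ ls b σ → Args σ b ls v →
                Prefix (compile f ls b) (recBody (compile g (1 + b ∷ b ∷ ls) (3 + b)) b) b σ 0 r
  prefix-zero d ls b σ a m with compile-correct d ls b σ a
  ... | σ₁ , e , refl , ag = σ₁ , e , ag , λ σ₂ l → σ₂ , l , λ _ w → w

  prefix-suc : ∀ {n} {f : PR n} {g : PR (2 + n)} {v k r′ r} →
               prec f g ⟦ k ∷ v ⟧⇓ r′ → g ⟦ k ∷ r′ ∷ v ⟧⇓ r → ∀ ls b σ → Args σ b ls v →
               Prefix (compile f ls b) (recBody (compile g (1 + b ∷ b ∷ ls) (3 + b)) b) b σ (suc k) r
  -- The first `k` rounds are asked to leave `suc m` rounds over, so that one more can be run with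
  -- `m` remaining.
  prefix-suc {g = g} {k = k} d e ls b σ a m with prefix d ls b σ a (suc m)
  ... | σ₁ , e₁ , ag₁ , extend = σ₁ , e₁ , ag₁ , extend′
    where
    extend′ : ∀ σ₂ → Loop b σ σ₂ (σ₁ b) 0 (suc k + m) → _
    extend′ σ₂ l₂ with extend σ₂ (subst (Loop b σ σ₂ (σ₁ b) 0) (sym (+-suc k m)) l₂)
    ... | σ₃ , l₃@(loop p i q ag₃) , back
      with recBody-correct l₃ (compile-correct e (1 + b ∷ b ∷ ls) (3 + b) σ₃
             ((n≤1+n _ , i) ∷ (m≤n+m (1 + b) 2 , p) ∷ args-mono (m≤n+m b 3) ag₃ a))
    ... | σ₄ , e₄ , l₄ = σ₄ , l₄ , λ σ₅ w → back σ₅ (while₁ q e₄ w)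

  prefix : ∀ {n} {f : PR n} {g : PR (2 + n)} {v k r} → prec f g ⟦ k ∷ v ⟧⇓ r → ∀ ls b σ → Args σ b ls v →
           Prefix (compile f ls b) (recBody (compile g (1 + b ∷ b ∷ ls) (3 + b)) b) b σ k r
  prefix (prec0 d)   = prefix-zero d
  prefix (precS d e) = prefix-suc d e

  prec-finish : ∀ {n} {f : PR n} {g : PR (2 + n)} {k r l b σ} {ls : Vec ℕ n} → Stored σ b l k →
                Prefix (compile f ls b) (recBody (compile g (1 + b ∷ b ∷ ls) (3 + b)) b) b σ k r →
                Yields (compile (prec f g) (l ∷ ls) b) b r σ
  -- With no rounds left over, the counter ends at zero and the loop stops.
  prec-finish {k = k} {l = l} {b} {σ} (l<b , p) pre with pre 0
  ... | σ₁ , e₁ , ag₁ , extend = finish (extend _ start)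
    where
    σ₂ : Store
    σ₂ = σ₁ [ 1 + b ≔ nil ]
    start : Loop b σ (σ₂ [ 2 + b ≔ copy l ]) (σ₁ b) 0 (k + 0)
    start = loop
      (trans (unassigned σ₂ (2 + b) (copy l) b (<⇒≢ (n≤1+n (1 + b))))
        (unassigned σ₁ (1 + b) nil b (<⇒≢ ≤-refl)))
      (trans (unassigned σ₂ (2 + b) (copy l) (1 + b) (<⇒≢ ≤-refl)) (assigned σ₁ (1 + b) nil))
      (trans (assigned σ₂ (2 + b) (copy l)) (trans (agree-set (n≤1+n b) l l<b)
        (trans (ag₁ l l<b) (trans p (sym (+-identityʳ k))))))
      (agree-trans ag₁ (agree-trans (agree-set (m≤n+m b 1)) (agree-set (m≤n+m b 2))))
    finish : _ → _
    finish (σ₃ , loop q _ z ag₃ , back) = σ₃ , e₁ ⨾ set ⨾ set ⨾ back σ₃ (while₀ z) , q , ag₃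

  compileAll-correct : ∀ {m n} {gs : Vec (PR n) m} {v ws} → gs ⟦ v ⟧⇓* ws → ∀ ls b σ → Args σ b ls v →
                       Σ Store λ σ′ →
                       compileAll gs ls b ∶ σ ⇓ σ′ × Args σ′ (m + b) (range b m) ws × Agree b σ σ′
  compileAll-correct []       ls b σ a = σ , skip , [] , λ _ _ → refl
  compileAll-correct {suc m} (_∷_ {rs = ws} d ds) ls b σ a with compile-correct d ls b σ a
  ... | σ₁ , e₁ , p , ag₁ with compileAll-correct ds ls (suc b) σ₁ (args-mono (n≤1+n b) ag₁ a)
  ... | σ₂ , e₂ , a₂ , ag₂ =
    σ₂ , e₁ ⨾ e₂ ,
    (s≤s (m≤n+m b m) , trans (ag₂ b ≤-refl) p) ∷ subst (λ k → Args σ₂ k (range (suc b) m) ws) (+-suc m b) a₂ ,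
    agree-trans ag₁ (agree-≤ (n≤1+n b) ag₂)

program : PR 1 → Program
program p = flatten (compile p (0 ∷ []) 1) 0

input : ℕ → Store
input n zero    = n
input n (suc _) = 0

Outputs : Program → ℕ → ℕ → Set
Outputs π n r = Σ Store λ σ → Reaches π (0 , input n) (length π , σ) × σ 1 ≡ r

program-correct : ∀ {p n r} → p ⟦ n ∷ [] ⟧⇓ r → Outputs (program p) n r
program-correct {p} {n} d with compile-correct d (0 ∷ []) 1 (input n) ((s≤s z≤n , refl) ∷ [])
... | σ , e , q , _ =
  σ , subst (λ k → Reaches (program p) (0 , input n) (k , σ)) (sym (length-flatten (compile p (0 ∷ []) 1) 0))
        (flatten-correct (codeAt-self (program p)) e) , q

module _ {A : Set} {e : A → ℕ} {F : A → Formula} (p : PR 1) (c : Computable e F) where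

  composite : Program
  composite = program (comp p (algorithm c ∷ []))

  composite-correct : ∀ a {r} → p ⟦ code (F a) ∷ [] ⟧⇓ r → Outputs composite (e a) r
  composite-correct a d = program-correct (comp (correct c a ∷ []) d)

-- The grid formula

data Label : Set where
  first initial blank : Label
  digit state         : ℕ → Label

interleave : ℕ → ℕ → ℕ
interleave k zero    = k
interleave k (suc i) = suc (suc (interleave k i))

index : Label → ℕ
index first     = 0
index initial   = 1
index blank     = 2
index (digit i) = 3 + interleave 0 i
index (state q) = 3 + interleave 1 q

bump : Label → Label
bump (digit i) = digit (suc i)
bump (state q) = state (suc q)
bump l         = l

-- A structure interprets a unary symbol for every number, so the model has to decode numbers into
-- labels. From 3 on digits and states alternate, hence the steps of two.
label : ℕ → Label
label 0                   = first
label 1                   = initial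
label 2                   = blank
label 3                   = digit 0
label 4                   = state 0
label (suc (suc k@(suc (suc (suc _))))) = bump (label k)

label-index : ∀ l → label (index l) ≡ l
label-index first           = refl
label-index initial         = refl
label-index blank           = refl
label-index (digit zero)    = refl
label-index (digit (suc i)) = cong bump (label-index (digit i))
label-index (state zero)    = refl
label-index (state (suc q)) = cong bump (label-index (state q))

pattern v₀ = zero
pattern v₁ = suc zero
pattern v₂ = suc (suc zero)
pattern v₃ = suc (suc (suc zero))
pattern right = zero
pattern down  = suc zero

has hasnt : Label → Var → Formula
has l x   = unary (index l) x
hasnt l x = neg x (has l x)

top : Formula
top = eq v₀ v₀

implies : Label → Formula → Formula
implies l φ = or (hasnt l v₀) φ

same : Label → Var → Label → Var → Formula
same l x m y = or (and (has l x) (has m y)) (and (hasnt l x) (hasnt m y))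

conj : ℕ → (ℕ → Formula) → Formula
conj zero    φ = top
conj (suc n) φ = and (φ n) (conj n φ)

-- A register holds the value v when its digits are set exactly in columns 0, …, v ∸ 1.
-- Around the cell v₀, the variables v₁, v₂, v₃ are its neighbours to the right, below and diagonally.
update-digit : ℕ → Expr → Formula
update-digit i nil      = hasnt (digit i) v₂
update-digit i (copy r) = same (digit r) v₀ (digit i) v₂
update-digit i (decr r) = same (digit r) v₁ (digit i) v₂
update-digit i (incr r) = and (same (digit r) v₀ (digit i) v₃) (implies first (has (digit i) v₂))

-- In the first column the digit of `r` tells whether `r` is nonzero. Therefore `rule` imposes this
-- at `first` only, and the new state reaches the rest of its row by spreading to the right.
update-state : ℕ → Instr → Formula
update-state q (assign _ _)     = has (state (suc q)) v₂
update-state q (branch r q₀ q₁) =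
  or (and (has (digit r) v₀) (has (state q₁) v₂)) (and (hasnt (digit r) v₀) (has (state q₀) v₂))

rule : ℕ → ℕ → Instr → Formula
rule K q ι = implies (state q) (and (conj K (λ i → update-digit i (transfer ι i)))
                                    (implies first (update-state q ι)))

register : Expr → ℕ
register nil      = 0
register (copy r) = r
register (incr r) = r
register (decr r) = r

weight : Instr → ℕ
weight (assign _ e)     = register e
weight (branch r q₀ q₁) = r + (q₀ + q₁)

weights : Program → ℕ
weights []      = 0
weights (ι ∷ π) = weight ι + weights π

-- A common strict bound for the relevant registers and program locations.
bound : Program → ℕ
bound π = 2 + (length π + weights π)

square : Formula
square = and (binary right v₀ v₁) (and (binary down v₀ v₂) (and (binary down v₁ v₃) (binary right v₂ v₃)))

-- In order: the left border continues downwards; in the initial row all registers but 0 are empty;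
-- beyond the input register 0 is empty too; states fill their rows; a halting row does not have a
-- nonzero register 1; the instructions are obeyed.
local : Program → Formula
local π =
  and (implies first (has first v₂))
  (and (implies initial (and (has initial v₁) (conj (bound π) (λ i → hasnt (digit (suc i)) v₀))))
  (and (implies blank (and (has blank v₁) (hasnt (digit 0) v₀)))
  (and (conj (bound π) (λ q → implies (state q) (has (state q) v₁)))
  (and (implies (state (length π)) (implies first (hasnt (digit 1) v₀)))
       (conj (length π) (λ q → maybe (rule (bound π) q) top (fetch π q)))))))

-- A statement of the form ∀∃∃∃, written with ¬∃¬. Both negations meet at most the free variable
-- `v₀`, although the square inside uses four variables.
grid : Program → Formula
grid π = neg v₀ (ex v₀ (neg v₀ (ex v₁ (ex v₂ (ex v₃ (and square (local π)))))))

-- Requantifying `v₀` and equating it with `v₁` moves the focus one cell to the right, so two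
-- variables walk along an input of any length.
tapeStep : Formula → Formula
tapeStep φ = and (has (digit 0) v₀) (ex v₁ (and (binary right v₀ v₁) (ex v₀ (and (eq v₀ v₁) φ))))

tape : ℕ → Formula
tape zero    = has blank v₀
tape (suc n) = tapeStep (tape n)

-- Binding all four variables in front makes the formula closed whatever stands inside.
start : ℕ → Formula
start n = ex v₃ (ex v₂ (ex v₁ (ex v₀
  (and (has first v₀) (and (has initial v₀) (and (has (state 0) v₀) (tape n)))))))

-- The formulas lie in the fragment and are closed

hasnt-UNFO : ∀ l x → UNFO (hasnt l x)
hasnt-UNFO l x = neg unary λ { _ unary → refl }

implies-UNFO : ∀ l {φ} → UNFO φ → UNFO (implies l φ)
implies-UNFO l = or (hasnt-UNFO l v₀)

same-UNFO : ∀ l x m y → UNFO (same l x m y)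
same-UNFO l x m y = or (and unary unary) (and (hasnt-UNFO l x) (hasnt-UNFO m y))

conj-UNFO : ∀ n {φ} → (∀ i → UNFO (φ i)) → UNFO (conj n φ)
conj-UNFO zero    u = eq
conj-UNFO (suc n) u = and (u n) (conj-UNFO n u)

update-digit-UNFO : ∀ i e → UNFO (update-digit i e)
update-digit-UNFO i nil      = hasnt-UNFO (digit i) v₂
update-digit-UNFO i (copy r) = same-UNFO (digit r) v₀ (digit i) v₂
update-digit-UNFO i (decr r) = same-UNFO (digit r) v₁ (digit i) v₂
update-digit-UNFO i (incr r) = and (same-UNFO (digit r) v₀ (digit i) v₃) (implies-UNFO first unary)

update-state-UNFO : ∀ q ι → UNFO (update-state q ι)
update-state-UNFO q (assign _ _)   = unary
update-state-UNFO q (branch r _ _) = or (and unary unary) (and (hasnt-UNFO (digit r) v₀) unary)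

rule-UNFO : ∀ K q ι → UNFO (rule K q ι)
rule-UNFO K q ι = implies-UNFO (state q)
  (and (conj-UNFO K λ i → update-digit-UNFO i (transfer ι i)) (implies-UNFO first (update-state-UNFO q ι)))

fetched-UNFO : ∀ K q m → UNFO (maybe (rule K q) top m)
fetched-UNFO K q (just ι) = rule-UNFO K q ι
fetched-UNFO K q nothing  = eq

local-UNFO : ∀ π → UNFO (local π)
local-UNFO π =
  and (implies-UNFO first unary)
  (and (implies-UNFO initial (and unary (conj-UNFO _ λ i → hasnt-UNFO (digit (suc i)) v₀)))
  (and (implies-UNFO blank (and unary (hasnt-UNFO (digit 0) v₀)))
  (and (conj-UNFO _ λ q → implies-UNFO (state q) unary)
  (and (implies-UNFO (state (length π)) (implies-UNFO first (hasnt-UNFO (digit 1) v₀)))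
       (conj-UNFO _ λ q → fetched-UNFO _ q (fetch π q))))))

all-bound : ∀ {φ} y → ¬ FreeIn y (ex v₃ (ex v₂ (ex v₁ (ex v₀ φ))))
all-bound v₀ (ex _ (ex _ (ex _ (ex y≢ _)))) = y≢ refl
all-bound v₁ (ex _ (ex _ (ex y≢ _)))        = y≢ refl
all-bound v₂ (ex _ (ex y≢ _))               = y≢ refl
all-bound v₃ (ex y≢ _)                      = y≢ refl

only-v₀ : ∀ {φ} y → FreeIn y (ex v₁ (ex v₂ (ex v₃ φ))) → y ≡ v₀
only-v₀ v₀ _                         = refl
only-v₀ v₁ (ex y≢ _)                 = contradiction refl y≢
only-v₀ v₂ (ex _ (ex y≢ _))          = contradiction refl y≢
only-v₀ v₃ (ex _ (ex _ (ex y≢ _)))   = contradiction refl y≢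

grid-closed : ∀ π y → ¬ FreeIn y (grid π)
grid-closed π y (neg (ex y≢ (neg free))) = y≢ (only-v₀ y free)

tape-UNFO : ∀ n → UNFO (tape n)
tape-UNFO zero    = unary
tape-UNFO (suc n) = and unary (ex (and binary (ex (and eq (tape-UNFO n)))))

grid-UNFO : ∀ π → UNFO (grid π)
grid-UNFO π =
  neg (ex (neg (ex (ex (ex (and (and binary (and binary (and binary binary))) (local-UNFO π)))))
               only-v₀))
      (λ { y (ex y≢ (neg free)) → contradiction (only-v₀ y free) y≢ })

sentence : ∀ π n → Sentence (and (grid π) (start n))
sentence π n =
  and (grid-UNFO π) (ex (ex (ex (ex (and unary (and unary (and unary (tape-UNFO n)))))))) ,
  λ { y (andˡ free) → grid-closed π y free ; y (andʳ free) → all-bound y free }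

-- Finite conjunctions and bounds on registers and locations

module _ {M : Structure} {ρ : Var → Carrier M} where

  conj-elim : ∀ {n} φ → M ⊨ conj n φ [ ρ ] → ∀ i → i < n → M ⊨ φ i [ ρ ]
  conj-elim {suc n} φ (p , ps) i (s≤s i≤n) with m≤n⇒m<n∨m≡n i≤n
  ... | inj₁ i<n  = conj-elim φ ps i i<n
  ... | inj₂ refl = p

  conj-intro : ∀ n φ → (∀ i → i < n → M ⊨ φ i [ ρ ]) → M ⊨ conj n φ [ ρ ]
  conj-intro zero    φ p = refl
  conj-intro (suc n) φ p = p n ≤-refl , conj-intro n φ λ i i<n → p i (m<n⇒m<1+n i<n)

weight-≤ : ∀ π q {ι} → fetch π q ≡ just ι → weight ι ≤ weights π
weight-≤ (ι ∷ π) zero    refl = m≤m+n (weight ι) (weights π)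
weight-≤ (ι ∷ π) (suc q) p    = ≤-trans (weight-≤ π q p) (m≤n+m (weights π) (weight ι))

weight-< : ∀ π q {ι k} → fetch π q ≡ just ι → k ≤ weight ι → k < bound π
weight-< π q p k≤ =
  s≤s (≤-trans k≤ (≤-trans (weight-≤ π q p) (≤-trans (m≤n+m (weights π) (length π)) (n≤1+n _))))

register-< : ∀ π q ι i → fetch π q ≡ just ι → i < bound π → register (transfer ι i) < bound π
register-< π q (branch _ _ _) i p i<K = i<K
register-< π q (assign b e)   i p i<K with does (i ≟ b)
... | true  = weight-< π q p ≤-refl
... | false = i<K

target-< : ∀ π q ι σ → fetch π q ≡ just ι → target ι q σ < bound π
target-< π q (assign _ _) σ p =
  s≤s (≤-trans (fetch-< π q p) (≤-trans (m≤m+n (length π) (weights π)) (n≤1+n _)))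
target-< π q (branch r q₀ q₁) σ p with σ r
... | zero  = weight-< π q p (≤-trans (m≤m+n q₀ q₁) (m≤n+m (q₀ + q₁) r))
... | suc _ = weight-< π q p (≤-trans (m≤n+m q₁ q₀) (m≤n+m (q₀ + q₁) r))

-- Accepting runs refute the formula

-- Universal quantification in UNFO is ¬∃¬, so what the formula says about cells is known only up
-- to double negation.
Digit : Set → ℕ → ℕ → Set
Digit A j v = (j < v → ¬ ¬ A) × (v ≤ j → ¬ A)

-- Both halves of `Digit` end in a negation, so it may be proved from cells whose existence is only
-- doubly negated.
digit-stable : ∀ {A j v} → ¬ ¬ Digit A j v → Digit A j v
digit-stable nn = (λ j<v k → nn λ d → proj₁ d j<v k) , (λ v≤j a → nn λ d → proj₂ d v≤j a)

digit-same : ∀ {A B j v} → (A × B) ⊎ (¬ A × ¬ B) → Digit A j v → Digit B j v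
digit-same (inj₁ (a , b))   d = (λ _ k → k b) , (λ v≤j _ → proj₂ d v≤j a)
digit-same (inj₂ (¬a , ¬b)) d = (λ j<v _ → proj₁ d j<v ¬a) , (λ _ → ¬b)

digit-suc : ∀ {A j v} → Digit A j v → Digit A (suc j) (suc v)
digit-suc (p , q) = (λ { (s≤s j<v) → p j<v }) , (λ { (s≤s v≤j) → q v≤j })

digit-pred : ∀ {A j v} → Digit A (suc j) v → Digit A j (pred v)
digit-pred {v = zero}  (p , q) = (λ ()) , (λ _ → q z≤n)
digit-pred {v = suc v} (p , q) = (λ j<v → p (s≤s j<v)) , (λ v≤j → q (s≤s v≤j))

modus-ponens : {A B : Set} → ¬ A ⊎ B → A → B
modus-ponens (inj₁ ¬a) a = contradiction a ¬a
modus-ponens (inj₂ b)  _ = b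

module Refutation (M : Structure) (functional : Functional M) (π : Program)
                  (ρ : Var → Carrier M) (M⊨grid : M ⊨ grid π [ ρ ]) where

  Is : Label → Carrier M → Set
  Is l = U M (index l)

  Right Down : Carrier M → Carrier M → Set
  Right = R M right
  Down  = R M down

  around : (x y z w : Carrier M) → Var → Carrier M
  around x y z w = update (update (update (update ρ v₀ x) v₁ y) v₂ z) v₃ w

  inspect : ∀ x → ¬ (∀ y z w → Right x y → Down x z → Down y w → Right z w →
                     M ⊨ local π [ around x y z w ] → ⊥)
  inspect x k = M⊨grid (x , λ { (y , z , w , (r , d , d′ , r′) , l) → k y z w r d d′ r′ l })

  data Path (a : Carrier M) : ℕ → Carrier M → Set where
    here : Path a 0 a
    _▹_  : ∀ {j x y} → Path a j x → Right x y → Path a (suc j) y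

  -- Paths grow at their far end; functionality of `Right` identifies the first edge with the given
  -- one.
  path-tail : ∀ {a y j x} → Right a y → Path a (suc j) x → Path y j x
  path-tail r (here ▹ r′) with functional right _ _ _ r r′
  ... | refl = here
  path-tail r (p@(_ ▹ _) ▹ r′) = path-tail r p ▹ r′

  -- Induction along the path: the square at each cell supplies some right neighbour, and
  -- functionality makes it the next cell of the path.
  spread : ∀ {a} l → (∀ {x y z w} → M ⊨ local π [ around x y z w ] → Is l x → Is l y) →
           ¬ ¬ Is l a → ∀ {j x} → Path a j x → ¬ ¬ Is l x
  spread l prop nn here            k = nn k
  spread l prop nn (_▹_ {x = x} p r) k =
    spread l prop nn p λ lx → inspect x λ y z w r′ _ _ _ loc →
      k (subst (Is l) (functional right _ _ _ r′ r) (prop loc lx))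

  K : ℕ
  K = bound π

  record Row (a : Carrier M) (c : Config) : Set where
    field
      state-at : ∀ {j x} → Path a j x → ¬ ¬ Is (state (proj₁ c)) x
      digit-at : ∀ {j x} → Path a j x → ∀ i → i < K → Digit (Is (digit i) x) j (proj₂ c i)

  open Row

  spread-state : ∀ q → q < K → ∀ {a} → ¬ ¬ Is (state q) a → ∀ {j x} → Path a j x → ¬ ¬ Is (state q) x
  spread-state q q<K = spread (state q) λ { (_ , _ , _ , s , _) →
    modus-ponens (conj-elim (λ q → implies (state q) (has (state q) v₁)) s q q<K) }

  spread-initial : ∀ {a} → Is initial a → ∀ {j x} → Path a j x → ¬ ¬ Is initial x
  spread-initial ia = spread initial (λ { (_ , i , _) x → proj₁ (modus-ponens i x) }) (λ k → k ia)

  spread-blank : ∀ {a} → Is blank a → ∀ {j x} → Path a j x → ¬ ¬ Is blank x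
  spread-blank ba = spread blank (λ { (_ , _ , b , _) x → proj₁ (modus-ponens b x) }) (λ k → k ba)

  tape-digit : ∀ n ρ′ → M ⊨ tape n [ ρ′ ] → ∀ {j x} → Path (ρ′ v₀) j x → Digit (Is (digit 0) x) j n
  tape-digit zero ρ′ b {x = x} p =
    (λ ()) , λ _ d → spread-blank b p λ bx → inspect x λ { _ _ _ _ _ _ _ (_ , _ , l , _) →
      proj₂ (modus-ponens l bx) d }
  tape-digit (suc n) ρ′ (d , _) here = (λ _ k → k d) , λ ()
  tape-digit (suc n) ρ′ (_ , y , r , _ , refl , t) p@(_ ▹ _) =
    digit-suc (tape-digit n _ t (path-tail r p))

  initial-row : ∀ n ρ′ → M ⊨ tape n [ ρ′ ] → Is initial (ρ′ v₀) → Is (state 0) (ρ′ v₀) →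
                Row (ρ′ v₀) (0 , input n)
  initial-row n ρ′ t i s = record
    { state-at = spread-state 0 (s≤s z≤n) (λ k → k s)
    ; digit-at = λ { p zero _ → tape-digit n ρ′ t p
                   ; {x = x} p (suc r) r<K → (λ ()) , λ _ d → spread-initial i p λ ix →
                       inspect x λ { _ _ _ _ _ _ _ (_ , l , _) →
                         conj-elim (λ i → hasnt (digit (suc i)) v₀)
                           (proj₂ (modus-ponens l ix)) r (<⇒≤ r<K) d } } }


  -- Where the squares produce a grid: if `u` lies over `x′`, the square at `u` has `x′` as its
  -- lower left corner and the right neighbour of `x′` as its diagonal corner, by functionality of
  -- both relations. So the right neighbour of `u` lies over the next cell.
  above : ∀ {a b j x} → Down a b → Path b j x → ¬ (∀ u → Path a j u → Down u x → ⊥)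
  above d here    k = k _ here d
  above {x = x} d (_▹_ {x = x′} p r) k = above d p λ u q e → inspect u λ y z w r₁ d₁ d₂ r₂ _ →
    k y (q ▹ r₁)
      (subst (Down y) (functional right x′ _ _ (subst (λ z → Right z w) (functional down _ _ _ d₁ e) r₂) r) d₂)

  module Advance {a b : Carrier M} {q : ℕ} {σ : Store} {ι : Instr} (fetched : fetch π q ≡ just ι) (fst : Is first a) (row : Row a (q , σ))
                 (d : Down a b) where

    Updated : (x y z w : Carrier M) → Set
    Updated x y z w = (∀ i → i < K → M ⊨ update-digit i (transfer ι i) [ around x y z w ]) ×
                      (Is first x → M ⊨ update-state q ι [ around x y z w ])

    obey : ∀ {x y z w} → Is (state q) x → M ⊨ local π [ around x y z w ] → Updated x y z w
    obey sx (_ , _ , _ , _ , _ , rules)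
      with subst (λ m → M ⊨ maybe (rule K q) top m [ _ ]) fetched
             (conj-elim (λ q → maybe (rule K q) top (fetch π q)) rules q (fetch-< π q fetched))
    ... | r with modus-ponens r sx
    ... | ds , s = conj-elim (λ i → update-digit i (transfer ι i)) ds , modus-ponens s

    below : ∀ {j x} → Path b j x →
            ¬ (∀ u y w → Path a j u → Right u y → Right x w → Updated u y x w → ⊥)
    below p k = above d p λ u q e → state-at row q λ su → inspect u λ y z w r d _ r′ l →
      help k q su y z w r (functional down _ _ _ d e) r′ l
      where
      help : ∀ {j x u} → (∀ u y w → Path a j u → Right u y → Right x w → Updated u y x w → ⊥) →
             Path a j u → Is (state q) u → ∀ y z w → Right u y → z ≡ x → Right z w →
             M ⊨ local π [ around u y z w ] → ⊥
      help k q su y z w r refl r′ l = k _ y w q r r′ (obey su l)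

    -- In unary, decrementing shifts the digits left, so the cell below is compared with the right
    -- neighbour; incrementing shifts them right, so the diagonal cell is compared and the first
    -- column is set separately.
    next-digit : ∀ i e → transfer ι i ≡ e → i < K → register e < K →
                 ∀ {j x} → Path b j x → Digit (Is (digit i) x) j (eval e σ)
    next-digit i nil t≡e i<K r<K p = digit-stable λ k → below p λ u y w q _ _ upd →
      k ((λ ()) , λ _ → subst (λ e → M ⊨ update-digit i e [ _ ]) t≡e (proj₁ upd i i<K))
    next-digit i (copy r) t≡e i<K r<K p = digit-stable λ k → below p λ u y w q _ _ upd →
      k (digit-same (subst (λ e → M ⊨ update-digit i e [ _ ]) t≡e (proj₁ upd i i<K)) (digit-at row q r r<K))
    next-digit i (decr r) t≡e i<K r<K p = digit-stable λ k → below p λ u y w q rt _ upd →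
      k (digit-pred (digit-same (subst (λ e → M ⊨ update-digit i e [ _ ]) t≡e (proj₁ upd i i<K))
                                (digit-at row (q ▹ rt) r r<K)))
    next-digit i (incr r) t≡e i<K r<K here =
      (λ _ k → below here λ { _ _ _ here _ _ upd →
        k (modus-ponens (proj₂ (subst (λ e → M ⊨ update-digit i e [ _ ]) t≡e (proj₁ upd i i<K)))
                        fst) }) , λ ()
    next-digit i (incr r) t≡e i<K r<K (p ▹ rt) = digit-stable λ k → below p λ u y w q _ rt′ upd →
      k (subst (λ x → Digit (Is (digit i) x) _ _) (functional right _ _ _ rt′ rt)
        (digit-suc (digit-same (proj₁ (subst (λ e → M ⊨ update-digit i e [ _ ]) t≡e (proj₁ upd i i<K)))
                               (digit-at row q r r<K))))

    next-state : ¬ ¬ Is (state (target ι q σ)) b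
    next-state k = below here λ { _ _ _ here _ _ upd → by-instr ι (weight-< π q fetched) (proj₂ upd fst) k }
      where
      by-instr : ∀ {y w} ι → (∀ {k} → k ≤ weight ι → k < K) → M ⊨ update-state q ι [ around a y b w ] →
                 ¬ ¬ Is (state (target ι q σ)) b
      by-instr (assign _ _) _ s k = k s
      by-instr (branch r q₀ q₁) small s k with σ r | digit-at row here r (small (m≤m+n r _)) | s
      ... | zero  | dig | inj₁ (dr , _) = proj₂ dig z≤n dr
      ... | zero  | dig | inj₂ (_ , s₀) = k s₀
      ... | suc _ | dig | inj₁ (_ , s₁) = k s₁
      ... | suc _ | dig | inj₂ (¬dr , _) = proj₁ dig (s≤s z≤n) ¬dr

    advance : Row b (exec ι (q , σ))
    advance = record
      { state-at = spread-state (target ι q σ) (target-< π q ι σ fetched) next-state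
      ; digit-at = λ p i i<K → next-digit i (transfer ι i) refl i<K (register-< π q ι i fetched i<K) p }

  -- Induction on the run: an executed instruction leads one row down, a stuck configuration stays
  -- in its row. In the halting row, output 1 clashes with the ban on the first digit of register 1.
  refute-row : ∀ t {a} c → Is first a → Row a c → ∀ {σ} → run π t c ≡ (length π , σ) → ¬ σ 1 ≡ 1
  refute-row zero    (q , σ) fst row refl one =
    state-at row here λ s → inspect _ λ { _ _ _ _ _ _ _ (_ , _ , _ , _ , out , _) →
      proj₁ (digit-at row here 1 (s≤s (s≤s z≤n))) (≤-reflexive (sym one))
        (modus-ponens (modus-ponens out s) fst) }
  refute-row (suc t) {a} (q , σ) fst row halt one with fetch π q in fetched
  ... | nothing = refute-row t (q , σ) fst row halt one
  ... | just ι  = inspect a λ { _ z _ _ d _ _ (f , _) →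
    refute-row t (exec ι (q , σ)) (modus-ponens f fst) (Advance.advance fetched fst row d) halt one }

unsatisfiable : ∀ {π n} → Outputs π n 1 → ¬ Satisfiable (and (grid π) (start n))
unsatisfiable {π} {n} (_ , (t , halt) , one) (M , fun , ρ , M⊨grid , _ , _ , _ , _ , fst , ini , st , tp) =
  refute-row t (0 , input n) fst (initial-row n _ tp ini st) halt one
  where open Refutation M fun π ρ M⊨grid

-- Rejecting runs yield finite models

-- A successor capped at the last element: on a finite grid both moves stay total, with loops at the
-- far edges.
next : ∀ {n} → Fin (suc n) → Fin (suc n)
next {zero}  zero    = zero
next {suc n} zero    = suc zero
next {suc n} (suc i) = suc (next i)

next-cases : ∀ {n} (i : Fin (suc n)) → toℕ (next i) ≡ suc (toℕ i) ⊎ (toℕ i ≡ n × next i ≡ i)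
next-cases {zero}  zero    = inj₂ (refl , refl)
next-cases {suc n} zero    = inj₁ refl
next-cases {suc n} (suc i) with next-cases i
... | inj₁ p       = inj₁ (cong suc p)
... | inj₂ (p , q) = inj₂ (cong suc p , cong suc q)

next-<-suc : ∀ {n} (i : Fin (suc n)) {v} → suc v ≤ n → toℕ i < v → toℕ (next i) < suc v
next-<-suc i v<n i<v with next-cases i
... | inj₁ p       = subst (_< suc _) (sym p) (s≤s i<v)
... | inj₂ (_ , q) = subst (λ k → toℕ k < suc _) (sym q) (m<n⇒m<1+n i<v)

-- The cap could spoil the shift only in the last column, whose digit is unset as long as values do
-- not exceed `n`.
next-<-suc⁻¹ : ∀ {n} (i : Fin (suc n)) {v} → suc v ≤ n → toℕ (next i) < suc v → toℕ i < v
next-<-suc⁻¹ i v<n lt with next-cases i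
... | inj₁ p = ≤-pred (subst (_< suc _) p lt)
... | inj₂ (p , q) = contradiction (subst (_< suc _) (trans (cong toℕ q) p) lt) (≤⇒≯ v<n)

next-<-pred : ∀ {n} (i : Fin (suc n)) {v} → v ≤ n → toℕ (next i) < v → toℕ i < pred v
next-<-pred i {suc v} v≤n = next-<-suc⁻¹ i v≤n

next-<-pred⁻¹ : ∀ {n} (i : Fin (suc n)) {v} → v ≤ n → toℕ i < pred v → toℕ (next i) < v
next-<-pred⁻¹ i {suc v} v≤n = next-<-suc i v≤n

eval-≤ : ∀ e {σ m} → (∀ i → σ i ≤ m) → eval e σ ≤ suc m
eval-≤ nil      le = z≤n
eval-≤ (copy r) le = m≤n⇒m≤1+n (le r)
eval-≤ (incr r) le = s≤s (le r)
eval-≤ (decr r) le = ≤-trans pred[n]≤n (m≤n⇒m≤1+n (le r))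

step-≤ : ∀ π c {m} → (∀ i → proj₂ c i ≤ m) → ∀ i → proj₂ (step π c) i ≤ suc m
step-≤ π (q , σ) le i with fetch π q
... | just ι  = eval-≤ (transfer ι i) le
... | nothing = m≤n⇒m≤1+n (le i)

-- A step raises a register by at most one. This fixes the width of the model.
run-≤ : ∀ π t c {m} → (∀ i → proj₂ c i ≤ m) → ∀ i → proj₂ (run π t c) i ≤ m + t
run-≤ π zero    c {m} le i = subst (proj₂ c i ≤_) (sym (+-identityʳ m)) (le i)
run-≤ π (suc t) c {m} le i =
  subst (proj₂ (run π (suc t) c) i ≤_) (sym (+-suc m t)) (run-≤ π t (step π c) (step-≤ π c le) i)

input-≤ : ∀ n i → input n i ≤ n
input-≤ n zero    = ≤-refl
input-≤ n (suc _) = z≤n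

run-+ : ∀ π s t c → run π (s + t) c ≡ run π t (run π s c)
run-+ π zero    t c = refl
run-+ π (suc s) t c = run-+ π s t (step π c)

run-stuck : ∀ π t c → fetch π (proj₁ c) ≡ nothing → run π t c ≡ c
run-stuck π zero    c p = refl
run-stuck π (suc t) c p = trans (cong (run π t) (cong (maybe _ _) p)) (run-stuck π t c p)

-- One row for each time up to `T`, and columns 0 to `n + T`, enough for all register contents.
-- Cells are abstract up to a coding of positions, so that the carrier can be literally some `Fin`.
module Model (π : Program) (n T : ℕ) {τ : Store} (halt : run π T (0 , input n) ≡ (length π , τ))
             (rejects : τ 1 ≡ 0)
             (Cell : Set) (position : Cell → Fin (suc T) × Fin (suc (n + T)))
             (cell : Fin (suc T) × Fin (suc (n + T)) → Cell)
             (position-cell : ∀ p → position (cell p) ≡ p) where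

  N : ℕ
  N = n + T

  Position : Set
  Position = Fin (suc T) × Fin (suc N)

  conf : Fin (suc T) → Config
  conf t = run π (toℕ t) (0 , input n)

  pc : Fin (suc T) → ℕ
  pc t = proj₁ (conf t)

  store : Fin (suc T) → Store
  store t = proj₂ (conf t)

  -- The last row is its own successor, which agrees with `step` because the run has halted there.
  conf-next : ∀ t → conf (next t) ≡ step π (conf t)
  conf-next t with next-cases t
  ... | inj₁ p = trans (cong (λ k → run π k (0 , input n)) p) (run-step π (toℕ t) (0 , input n))
  ... | inj₂ (p , q) = trans (trans (cong conf q) halted)
                         (sym (trans (cong (step π) halted) (cong (maybe _ _) (fetch-length π))))
    where
    halted : conf t ≡ (length π , τ)
    halted = trans (cong (λ k → run π k (0 , input n)) p) halt

  store-≤ : ∀ t i → store t i ≤ N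
  store-≤ t i = ≤-trans (run-≤ π (toℕ t) (0 , input n) (input-≤ n) i) (+-monoʳ-≤ n (≤-pred (toℕ<n t)))

  Holds : Label → Position → Set
  Holds first     (t , j) = toℕ j ≡ 0
  Holds initial   (t , j) = toℕ t ≡ 0
  Holds blank     (t , j) = toℕ t ≡ 0 × n ≤ toℕ j
  Holds (digit i) (t , j) = toℕ j < store t i
  Holds (state q) (t , j) = pc t ≡ q

  -- Implications in the formula are disjunctions, so a disjunct has to be chosen by deciding
  -- labels.
  holds? : ∀ l p → Dec (Holds l p)
  holds? first     (t , j) = toℕ j ≟ 0
  holds? initial   (t , j) = toℕ t ≟ 0
  holds? blank     (t , j) = (toℕ t ≟ 0) ×-dec (n ≤? toℕ j)
  holds? (digit i) (t , j) = toℕ j <? store t i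
  holds? (state q) (t , j) = pc t ≟ q

  move : Fin 2 → Position → Position
  move right (t , j) = t , next j
  move down  (t , j) = next t , j

  M : Structure
  M = record { Carrier = Cell
             ; U = λ k a → Holds (label k) (position a)
             ; R = λ i a b → b ≡ cell (move i (position a)) }

  functional : Functional M
  functional i a b c p q = trans p (sym q)

  module _ (l : Label) {a : Cell} {p : Position} (at : position a ≡ p) where

    hold : Holds l p → U M (index l) a
    hold h = subst (λ l → Holds l (position a)) (sym (label-index l)) (subst (Holds l) (sym at) h)

    held : U M (index l) a → Holds l p
    held u = subst (Holds l) at (subst (λ l → Holds l (position a)) (label-index l) u)

  implies-intro : ∀ l {a p} {B : Set} → position a ≡ p → (Holds l p → B) → ¬ U M (index l) a ⊎ B
  implies-intro l {p = p} at f with holds? l p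
  ... | yes h = inj₂ (f h)
  ... | no ¬h = inj₁ λ u → ¬h (held l at u)

  same-intro : ∀ l m {a b p p′} → position a ≡ p → position b ≡ p′ →
               (Holds l p → Holds m p′) → (Holds m p′ → Holds l p) →
               (U M (index l) a × U M (index m) b) ⊎ (¬ U M (index l) a × ¬ U M (index m) b)
  same-intro l m {p = p} at at′ f g with holds? l p
  ... | yes h = inj₁ (hold l at h , hold m at′ (f h))
  ... | no ¬h = inj₂ ((λ u → ¬h (held l at u)) , λ u → ¬h (g (held m at′ u)))

  module At (t : Fin (suc T)) (j : Fin (suc N)) (ρ : Var → Cell)
            (at₀ : position (ρ v₀) ≡ (t , j))      (at₁ : position (ρ v₁) ≡ (t , next j))
            (at₂ : position (ρ v₂) ≡ (next t , j)) (at₃ : position (ρ v₃) ≡ (next t , next j)) where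

    update-digit-intro : ∀ i e → store (next t) i ≡ eval e (store t) → M ⊨ update-digit i e [ ρ ]
    update-digit-intro i nil      p u = n≮0 (subst (toℕ j <_) p (held (digit i) at₂ u))
    update-digit-intro i (copy r) p = same-intro (digit r) (digit i) at₀ at₂
      (subst (toℕ j <_) (sym p)) (subst (toℕ j <_) p)
    update-digit-intro i (decr r) p = same-intro (digit r) (digit i) at₁ at₂
      (λ lt → subst (toℕ j <_) (sym p) (next-<-pred j (store-≤ t r) lt))
      (λ lt → next-<-pred⁻¹ j (store-≤ t r) (subst (toℕ j <_) p lt))
    update-digit-intro i (incr r) p =
      same-intro (digit r) (digit i) at₀ at₃
        (λ lt → subst (toℕ (next j) <_) (sym p) (next-<-suc j small lt))
        (λ lt → next-<-suc⁻¹ j small (subst (toℕ (next j) <_) p lt)) ,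
      implies-intro first at₀ λ z → hold (digit i) at₂
        (subst (_< store (next t) i) (sym z) (subst (0 <_) (sym p) (s≤s z≤n)))
      where
      small : suc (store t r) ≤ N
      -- The incremented value is itself a register content in the next row, so the bound for that
      -- row keeps it off the cap.
      small = subst (_≤ N) p (store-≤ (next t) i)

    update-state-intro : ∀ q ι → toℕ j ≡ 0 → pc (next t) ≡ target ι q (store t) → M ⊨ update-state q ι [ ρ ]
    update-state-intro q (assign _ _)     z p = hold (state (suc q)) at₂ p
    update-state-intro q (branch r q₀ q₁) z p with store t r in eq
    ... | zero  = inj₂ ((λ u → n≮0 (subst (toℕ j <_) eq (held (digit r) at₀ u))) , hold (state q₀) at₂ p)
    ... | suc v = inj₁ (hold (digit r) at₀ (subst (_< store t r) (sym z) (subst (0 <_) (sym eq) (s≤s z≤n))) ,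
                        hold (state q₁) at₂ p)

    rule-intro : ∀ q m → fetch π q ≡ m → M ⊨ maybe (rule (bound π) q) top m [ ρ ]
    rule-intro q nothing  _ = refl
    rule-intro q (just ι) p = implies-intro (state q) at₀ λ s →
      conj-intro (bound π) (λ i → update-digit i (transfer ι i)) (λ i _ →
        update-digit-intro i (transfer ι i) (cong (λ c → proj₂ c i) (executed s))) ,
      implies-intro first at₀ λ z → update-state-intro q ι z
        (trans (cong proj₁ (executed s)) (cong (λ q → target ι q (store t)) s))
      where
      executed : pc t ≡ q → conf (next t) ≡ exec ι (conf t)
      executed s = trans (conf-next t) (cong (maybe _ _) (trans (cong (fetch π) s) p))

    -- The halting location may be reached before row `T`; as halted configurations are fixed, the
    -- store is already the final one, whose register 1 is 0.
    output-intro : pc t ≡ length π → toℕ j ≡ 0 → ¬ (toℕ j < store t 1)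
    output-intro s z lt = n≮0 (subst (toℕ j <_) (trans (cong (λ c → proj₂ c 1) final) rejects) lt)
      where
      final : conf t ≡ (length π , τ)
      final with m≤n⇒∃[o]m+o≡n (≤-pred (toℕ<n t))
      ... | o , t+o≡T =
        trans (sym (run-stuck π o (conf t) (trans (cong (fetch π) s) (fetch-length π))))
          (trans (sym (run-+ π (toℕ t) o (0 , input n)))
            (trans (cong (λ k → run π k (0 , input n)) t+o≡T) halt))

    local-intro : M ⊨ local π [ ρ ]
    local-intro =
      implies-intro first at₀ (λ z → hold first at₂ z) ,
      implies-intro initial at₀ (λ z → hold initial at₁ z ,
        conj-intro (bound π) (λ i → hasnt (digit (suc i)) v₀) λ i _ u →
          n≮0 (subst (λ k → toℕ j < proj₂ (run π k (0 , input n)) (suc i)) z (held (digit (suc i)) at₀ u))) ,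
      implies-intro blank at₀ (λ { (z , n≤j) → hold blank at₁ (z , ≤-trans n≤j next-≥) ,
        λ u → ≤⇒≯ n≤j (subst (λ k → toℕ j < proj₂ (run π k (0 , input n)) 0) z (held (digit 0) at₀ u)) }) ,
      conj-intro (bound π) (λ q → implies (state q) (has (state q) v₁)) (λ q _ →
        implies-intro (state q) at₀ λ s → hold (state q) at₁ s) ,
      implies-intro (state (length π)) at₀ (λ s → implies-intro first at₀ λ z u →
        output-intro s z (held (digit 1) at₀ u)) ,
      conj-intro (length π) (λ q → maybe (rule (bound π) q) top (fetch π q)) λ q _ →
        rule-intro q (fetch π q) refl
      where
      next-≥ : toℕ j ≤ toℕ (next j)
      next-≥ with next-cases j
      ... | inj₁ p       = subst (toℕ j ≤_) (sym p) (n≤1+n _)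
      ... | inj₂ (_ , q) = ≤-reflexive (cong toℕ (sym q))

  grid-intro : ∀ ρ → M ⊨ grid π [ ρ ]
  grid-intro ρ (a , k) =
    -- The two moves act on different coordinates, so both ways around the square end at the same
    -- position.
    k (cell (move right p) , cell (move down p) , cell (move right (move down p)) ,
       (refl , refl , cong (λ p → cell (move down p)) (sym (position-cell _)) ,
        cong (λ p → cell (move right p)) (sym (position-cell _))) ,
       At.local-intro (proj₁ p) (proj₂ p) _ refl (position-cell _) (position-cell _) (position-cell _))
    where
    p : Position
    p = position a

  tape-intro : ∀ m j → m + toℕ j ≡ n → ∀ ρ → position (ρ v₀) ≡ (zero , j) → M ⊨ tape m [ ρ ]
  tape-intro zero    j p ρ at = hold blank at (refl , ≤-reflexive (sym p))
  tape-intro (suc m) j p ρ at =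
    hold (digit 0) at j<n , cell (zero , next j) , cong (λ p → cell (move right p)) (sym at) ,
    cell (zero , next j) , refl ,
    tape-intro m (next j) (trans (cong (m +_) step-right) (trans (+-suc m (toℕ j)) p)) _ (position-cell _)
    where
    j<n : toℕ j < n
    j<n = subst (toℕ j <_) p (s≤s (m≤n+m (toℕ j) m))
    step-right : toℕ (next j) ≡ suc (toℕ j)
    step-right with next-cases j
    -- The input ends by column `n`, at or before the last column `n + T`, so the walk never meets
    -- the cap.
    ... | inj₁ q       = q
    ... | inj₂ (q , _) = contradiction (subst (_< n) q j<n) (≤⇒≯ (m≤m+n n T))

  start-intro : ∀ ρ → M ⊨ start n [ ρ ]
  start-intro ρ =
    o , o , o , o , hold first (position-cell _) refl , hold initial (position-cell _) refl ,
    hold (state 0) (position-cell _) refl , tape-intro n zero (+-identityʳ n) _ (position-cell _)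
    where
    o : Cell
    o = cell (zero , zero)

finitely-satisfiable : ∀ {π n} → Outputs π n 0 → FinSatisfiable (and (grid π) (start n))
finitely-satisfiable {π} {n} (_ , (T , halt) , rejects) =
  M , functional , suc T * suc (n + T) , refl , (λ _ → zero) , grid-intro _ , start-intro _
  where open Model π n T halt rejects (Fin (suc T * suc (n + T))) (remQuot (suc (n + T)))
                    (λ (t , j) → combine t j) (λ (t , j) → remQuot-combine t j)

-- The diagonal argument

tape-computable : Computable (λ n → n) tape
tape-computable = iterate-computable tape tapeStep (λ _ → refl)
  (and-computable (constant-computable _) (ex-computable v₁ (and-computable (constant-computable _)
  (ex-computable v₀ (and-computable (constant-computable _) (coding-computable (λ φ → φ)))))))

start-computable : Computable (λ n → n) start
start-computable =
  ex-computable v₃ (ex-computable v₂ (ex-computable v₁ (ex-computable v₀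
  (and-computable (constant-computable _) (and-computable (constant-computable _)
  (and-computable (constant-computable _) tape-computable))))))

liar : Program → Formula
liar π = and (grid π) (start (code (grid π)))

-- No decoding takes place: the input number is the code of the first conjunct, and the same number
-- determines the second.
liar-computable : Computable (λ π → code (grid π)) liar
liar-computable = and-computable {F = grid} {G = λ π → start (code (grid π))} (coding-computable grid) 
  (reindex-computable {e = λ n → n} {F = start} (λ π → code (grid π)) start-computable)

-- The program does not contain its own code but receives it as input, so the composite of `p` with
-- the algorithm for `liar` is already the fixed point.
self-reference : ∀ p → Σ Program λ π → ∀ r → p ⟦ code (liar π) ∷ [] ⟧⇓ r → Outputs π (code (grid π)) r
self-reference p =
  composite p liar-computable , λ r → composite-correct p liar-computable (composite p liar-computable) {r}

undecidable-between : (P : Formula → Set₁) → (∀ φ → FinSatisfiable φ → P φ) → (∀ φ → P φ → Satisfiable φ) →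
                      Undecidable P
undecidable-between P lower upper (p , decides) = contradict (self-reference p)
  where
  contradict : ¬ (Σ Program λ π → ∀ r → p ⟦ code (liar π) ∷ [] ⟧⇓ r → Outputs π (code (grid π)) r)
  contradict (π , outputs) = refute (decides (liar π) (sentence π (code (grid π))))
    where
    refute : ¬ (Σ Bool λ b → (p ⟦ code (liar π) ∷ [] ⟧⇓ bit b) × (T b ⇔ P (liar π)))
    refute (true  , d , iff) =
      unsatisfiable {π} {code (grid π)} (outputs 1 d) (upper (liar π) (Equivalence.to iff tt))
    refute (false , d , iff) =
      Equivalence.from iff (lower (liar π) (finitely-satisfiable {π} {code (grid π)} (outputs 0 d)))

fin⇒sat : ∀ φ → FinSatisfiable φ → Satisfiable φ
fin⇒sat φ (M , functional , _ , _ , ρ , sat) = M , functional , ρ , sat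

theorem13 : Undecidable Satisfiable × Undecidable FinSatisfiable
theorem13 = undecidable-between Satisfiable fin⇒sat (λ _ s → s) ,
            undecidable-between FinSatisfiable (λ _ s → s) fin⇒sat
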